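{- Let $k\ge 2$ and let $G$ be a $k$-partite graph with vertex partition $(V_1,\ldots,V_k)$ into independent sets. If $G$ is totally $k$-decomposable with respect to this partition, then the clique-width of $G$ is at most $2k$. Moreover, there is a $2k$-expression for $G$ that assigns, for each $i \in \{1,\ldots,k\}$, label $i$ to every vertex of $V_i$ (in the final labelled graph).
   Context: All graphs are finite, undirected, without multiple edges or self-loops. A graph is $k$-partite if its vertex set can be partitioned into $k$ independent sets, some of which may be empty. For disjoint vertex sets $X,Y$, $X$ is complete (anti-complete) to $Y$ if every vertex of $X$ is adjacent (non-adjacent) to every vertex of $Y$. Let $G$ be a $k$-partite graph with a fixed $k$-partition $(V_1,\ldots,V_k)$. A $k$-decomposition of $G$ with respect to $(V_1,\ldots,V_k)$ consists of two non-empty induced subgraphs $G'=G[V_1'\cup\cdots\cup V_k']$ with partition $(V_1',\ldots,V_k')$ and $G''=G[V_1''\cup\cdots\cup V_k'']$ with partition $(V_1'',\ldots,V_k'')$ such that: (i) for all $i$, $V_i'\cup V_i''=V_i$ and $V_i'\cap V_i''=\emptyset$; (ii) for all $i,j\in\{1,\ldots,k\}$, $V_i'$ is either complete or anti-complete to $V_j''$ in $G$. $G$ is totally $k$-decomposable with respect to $(V_1,\ldots,V_k)$ if it can be recursively $k$-decomposed into graphs isomorphic to $K_1$, where each graph $H$ occurring in the recursion is decomposed with respect to the inherited partition $(V_1\cap V(H),\ldots,V_k\cap V(H))$. The clique-width of $G$ is the minimum number of labels needed to construct $G$ using the operations: creating a new single vertex with label $i$; taking the disjoint union of two labelled graphs;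 joining each vertex with label $i$ to each vertex with label $j$ ($i\ne j$); renaming label $i$ to $j$. An algebraic term representing such a construction and using at most $m$ labels is an $m$-expression of $G$. -}

module Defs where

open import Level using (0ℓ)
open import Data.Bool using (if_then_else_)
open import Data.Empty using (⊥)
open import Data.Fin using (Fin; _≟_)
open import Data.Fin.Subset using (Subset; _∈_; _∪_; _∩_; Empty)
open import Data.Nat using (ℕ; _≤_)
open import Data.Product using (Σ; ∃; ∃-syntax; ∃!; _×_)
open import Data.Sum using (_⊎_; inj₁; inj₂)
open import Data.Unit using (⊤)
open import Function.Bundles using (_↔_; _⇔_; Inverse)
open import Relation.Binary.Core using (Rel)
open import Relation.Binary.Definitions using (Decidable; Symmetric)
open import Relation.Binary.PropositionalEquality using (_≡_; _≢_)
open import Relation.Nullary using (¬_; does)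

record Graph (n : ℕ) : Set₁ where
  field
    Adj    : Rel (Fin n) 0ℓ
    adj?   : Decidable Adj
    sym    : Symmetric Adj
    irrefl : ∀ v → ¬ Adj v v

module _ {n : ℕ} (G : Graph n) where
  open Graph G

  Independent : Subset n → Set
  Independent X = ∀ u v → u ∈ X → v ∈ X → ¬ Adj u v

  Complete : Subset n → Subset n → Set
  Complete X Y = ∀ x y → x ∈ X → y ∈ Y → Adj x y

  AntiComplete : Subset n → Subset n → Set
  AntiComplete X Y = ∀ x y → x ∈ X → y ∈ Y → ¬ Adj x y

-- Parts may be empty.
Family : ℕ → ℕ → Set
Family k n = Fin k → Subset n

infix 4 _∈⋃_

_∈⋃_ : {k n : ℕ} → Fin n → Family k n → Set
v ∈⋃ W = ∃[ i ] v ∈ W i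

record IsKPartition {k n : ℕ} (G : Graph n) (V : Family k n) : Set where
  field
    independent : ∀ i → Independent G (V i)
    disjoint    : ∀ i j → i ≢ j → Empty (V i ∩ V j)
    covers      : ∀ v → v ∈⋃ V

-- A family W of disjoint subsets stands for the induced subgraph
-- G[W₁ ∪ ⋯ ∪ Wₖ] together with its partition (W₁ , … , Wₖ).  Complete and
-- anti-complete pairs are the same in G and in its induced subgraphs, so the
-- recursion can stay inside G.
record IsKDecomposition {k n : ℕ} (G : Graph n) (W W′ W″ : Family k n) : Set where
  field
    nonempty′ : ∃[ v ] v ∈⋃ W′
    nonempty″ : ∃[ v ] v ∈⋃ W″
    union     : ∀ i → W′ i ∪ W″ i ≡ W i
    disjoint  : ∀ i → Empty (W′ i ∩ W″ i)
    uniform   : ∀ i j → Complete G (W′ i) (W″ j) ⊎ AntiComplete G (W′ i) (W″ j)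

-- Adjacency is irreflexive, so being isomorphic to K₁ is having exactly one
-- vertex.
data TotallyKDecomposable {k n : ℕ} (G : Graph n) (W : Family k n) : Set where
  isK₁      : ∃! _≡_ (_∈⋃ W) → TotallyKDecomposable G W
  decompose : (W′ W″ : Family k n) → IsKDecomposition G W W′ W″ →
              TotallyKDecomposable G W′ → TotallyKDecomposable G W″ →
              TotallyKDecomposable G W

data Expression (m : ℕ) : Set where
  single : (i : Fin m) → Expression m
  _⊕_    : (e₁ e₂ : Expression m) → Expression m
  join   : (i j : Fin m) → i ≢ j → Expression m → Expression m
  rename : (i j : Fin m) → Expression m → Expression m

Vertex : {m : ℕ} → Expression m → Set
Vertex (single i)     = ⊤
Vertex (e₁ ⊕ e₂)      = Vertex e₁ ⊎ Vertex e₂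
Vertex (join i j _ e) = Vertex e
Vertex (rename i j e) = Vertex e

label : {m : ℕ} (e : Expression m) → Vertex e → Fin m
label (single i)     _        = i
label (e₁ ⊕ e₂)      (inj₁ u) = label e₁ u
label (e₁ ⊕ e₂)      (inj₂ u) = label e₂ u
label (join i j _ e) u        = label e u
label (rename i j e) u        = if does (label e u ≟ i) then j else label e u

Edge : {m : ℕ} (e : Expression m) → Vertex e → Vertex e → Set
Edge (single i)     _        _        = ⊥
Edge (e₁ ⊕ e₂)      (inj₁ u) (inj₁ v) = Edge e₁ u v
Edge (e₁ ⊕ e₂)      (inj₁ u) (inj₂ v) = ⊥
Edge (e₁ ⊕ e₂)      (inj₂ u) (inj₁ v) = ⊥
Edge (e₁ ⊕ e₂)      (inj₂ u) (inj₂ v) = Edge e₂ u v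
Edge (join i j _ e) u        v        =
  Edge e u v ⊎ (label e u ≡ i × label e v ≡ j) ⊎ (label e u ≡ j × label e v ≡ i)
Edge (rename i j e) u        v        = Edge e u v

record _IsExpressionOf_ {m n : ℕ} (e : Expression m) (G : Graph n) : Set where
  field
    vertices : Fin n ↔ Vertex e
    edges    : ∀ u v → Graph.Adj G u v ⇔ Edge e (Inverse.to vertices u) (Inverse.to vertices v)

  -- The label that a vertex of G receives in the final labelled graph.
  labelOf : Fin n → Fin m
  labelOf v = label e (Inverse.to vertices v)

HasExpression : {n : ℕ} → Graph n → ℕ → Set
HasExpression G m = Σ (Expression m) (_IsExpressionOf G)

-- A relation rather than a function: computing the minimum would need a
-- decision procedure for HasExpression.
record IsCliqueWidth {n : ℕ} (G : Graph n) (w : ℕ) : Set where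
  field
    attained : HasExpression G w
    minimal  : ∀ m → HasExpression G m → w ≤ m

{-# OPTIONS --safe #-}
-- The two halves of a decomposition are built with labels 1, …, k.  Relabelling
-- i to k + i in the second half keeps the halves apart in their disjoint union,
-- and by uniformity the edges between them are joins of labels i and k + j.
-- Finally k + i is renamed back to i.  The label set Fin (2 * k) is treated as
-- Fin 2 × Fin k through combine and remQuot.
module Submission where

open import Defs
open import Data.Nat using (ℕ; _+_; _≤_; _*_)
open import Data.Fin using (toℕ)
open import Data.Fin.Subset using (_∈_)
open import Data.Product using (Σ; _×_)
open import Relation.Binary.PropositionalEquality using (_≡_)

open import Level using (0ℓ)
open import Data.Bool using (if_then_else_)
open import Data.Empty using (⊥-elim)
open import Data.Fin using (Fin; zero; suc; _≟_; combine; remQuot)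
open import Data.Fin.Properties using (any?; combine-injective; remQuot-combine; toℕ-combine)
open import Data.Fin.Subset.Properties using (_∈?_; x∈p∪q⁺; x∈p∪q⁻; x∈p∩q⁺)
open import Data.List using (List; []; _∷_; allFin; cartesianProduct)
open import Data.List.Membership.Propositional using () renaming (_∈_ to _∈ₗ_)
open import Data.List.Membership.Propositional.Properties using (∈-allFin; ∈-cartesianProduct⁺)
open import Data.List.Relation.Unary.Any using (here; there)
open import Data.Nat.Properties using (*-zeroʳ)
open import Data.Product using (_,_; proj₁; proj₂; ∃-syntax)
open import Data.Sum using (_⊎_; inj₁; inj₂; [_,_]′)
import Data.Sum as Sum
open import Function using (_∘_; _⇔_; mk⇔; Equivalence; id)
open import Function.Bundles using (mk↔ₛ′)
open import Relation.Binary.Core using (Rel)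
open import Relation.Binary.Definitions using (Decidable)
open import Relation.Binary.PropositionalEquality using (refl; sym; trans; cong; subst; subst₂; _≢_; module ≡-Reasoning)
open import Relation.Nullary using (¬_; Dec; yes; no; does; contradiction; _×-dec_)
open import Relation.Unary using (Pred)

open Equivalence using (to; from)

-- Expressions realising a labelled graph on a set of vertices

private
  variable
    k m n : ℕ

-- Specifying vertices, labels and edges on `Fin n` lets intermediate stages, whose edges are still
-- incomplete, be described without comparing vertex types. Since `vertex` maps into `S`, the values
-- of `ℓ` and `R` matter only there.
record Realisation (S : Pred (Fin n) 0ℓ) (ℓ : Fin n → Fin m) (R : Rel (Fin n) 0ℓ) : Set where
  field
    expression : Expression m
    vertex     : Vertex expression → Fin n
    vertex-∈   : ∀ x → S (vertex x)
    injective  : ∀ {x y} → vertex x ≡ vertex y → x ≡ y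
    surjective : ∀ {v} → S v → ∃[ x ] vertex x ≡ v
    labels     : ∀ x → label expression x ≡ ℓ (vertex x)
    edges      : ∀ x y → R (vertex x) (vertex y) ⇔ Edge expression x y

open Realisation

private
  variable
    S S₁ S₂ : Pred (Fin n) 0ℓ
    ℓ ℓ′ : Fin n → Fin m
    R R′ R₁ R₂ : Rel (Fin n) 0ℓ

realisation-resp : (∀ {v} → S₁ v ⇔ S₂ v) → (∀ {v} → S₁ v → ℓ v ≡ ℓ′ v) →
  (∀ {u v} → S₁ u → S₁ v → R′ u v ⇔ R u v) →
  Realisation S₁ ℓ R → Realisation S₂ ℓ′ R′
realisation-resp S⇔ ℓ≡ R⇔ r = record
  { expression = expression r
  ; vertex     = vertex r
  ; vertex-∈   = to S⇔ ∘ vertex-∈ r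
  ; injective  = injective r
  ; surjective = surjective r ∘ from S⇔
  ; labels     = λ x → trans (labels r x) (ℓ≡ (vertex-∈ r x))
  ; edges      = λ x y →
      let R⇔ₓ = R⇔ (vertex-∈ r x) (vertex-∈ r y) in
      mk⇔ (to (edges r x y) ∘ to R⇔ₓ) (from R⇔ₓ ∘ from (edges r x y))
  }

single-realisation : (v₀ : Fin n) → (∀ {v} → v₀ ≡ v ⇔ S v) → ¬ R v₀ v₀ →
  Realisation S ℓ R
single-realisation {ℓ = ℓ} v₀ S⇔ ¬R = record
  { expression = single (ℓ v₀)
  ; vertex     = λ _ → v₀
  ; vertex-∈   = λ _ → to S⇔ refl
  ; injective  = λ _ → refl
  ; surjective = λ Sv → _ , from S⇔ Sv
  ; labels     = λ _ → refl
  ; edges      = λ _ _ → mk⇔ ¬R ⊥-elim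
  }

-- A disjoint union has no edges between its sides, whereas a relation on `Fin n` may well hold
-- across them. Restricting both ends to one side removes those pairs.
Within : Pred (Fin n) 0ℓ → Rel (Fin n) 0ℓ → Rel (Fin n) 0ℓ
Within S R u v = S u × S v × R u v

⊕-realisation : (∀ {v} → S₁ v → ¬ S₂ v) →
  Realisation S₁ ℓ R₁ → Realisation S₂ ℓ R₂ →
  Realisation (λ v → S₁ v ⊎ S₂ v) ℓ (λ u v → Within S₁ R₁ u v ⊎ Within S₂ R₂ u v)
⊕-realisation {S₁ = S₁} {S₂ = S₂} {R₁ = R₁} {R₂ = R₂} disj r₁ r₂ = record
  { expression = e
  ; vertex     = vtx
  ; vertex-∈   = λ { (inj₁ x) → inj₁ (vertex-∈ r₁ x) ; (inj₂ y) → inj₂ (vertex-∈ r₂ y) }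
  ; injective  = inj
  ; surjective = [ (λ s → let (x , eq) = surjective r₁ s in inj₁ x , eq)
                 , (λ s → let (y , eq) = surjective r₂ s in inj₂ y , eq) ]′
  ; labels     = λ { (inj₁ x) → labels r₁ x ; (inj₂ y) → labels r₂ y }
  ; edges      = edg
  }
  where
  e = expression r₁ ⊕ expression r₂

  vtx : Vertex e → Fin _
  vtx = [ vertex r₁ , vertex r₂ ]′

  apart : ∀ x y → vertex r₁ x ≢ vertex r₂ y
  apart x y eq = disj (vertex-∈ r₁ x) (subst S₂ (sym eq) (vertex-∈ r₂ y))

  inj : ∀ {x y} → vtx x ≡ vtx y → x ≡ y
  inj {inj₁ x} {inj₁ y} eq = cong inj₁ (injective r₁ eq)
  inj {inj₁ x} {inj₂ y} eq = contradiction eq (apart x y)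
  inj {inj₂ x} {inj₁ y} eq = contradiction (sym eq) (apart y x)
  inj {inj₂ x} {inj₂ y} eq = cong inj₂ (injective r₂ eq)

  not₂ : ∀ x → ¬ S₂ (vertex r₁ x)
  not₂ x = disj (vertex-∈ r₁ x)

  not₁ : ∀ y → ¬ S₁ (vertex r₂ y)
  not₁ y s = disj s (vertex-∈ r₂ y)

  edg : ∀ x y → (Within S₁ R₁ (vtx x) (vtx y) ⊎ Within S₂ R₂ (vtx x) (vtx y)) ⇔ Edge e x y
  edg (inj₁ x) (inj₁ y) = mk⇔
    [ (λ (_ , _ , p) → to (edges r₁ x y) p) , (λ (s , _) → ⊥-elim (not₂ x s)) ]′
    (λ p → inj₁ (vertex-∈ r₁ x , vertex-∈ r₁ y , from (edges r₁ x y) p))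
  edg (inj₁ x) (inj₂ y) = mk⇔
    [ (λ (_ , s , _) → not₁ y s) , (λ (s , _) → not₂ x s) ]′ ⊥-elim
  edg (inj₂ x) (inj₁ y) = mk⇔
    [ (λ (s , _) → not₁ x s) , (λ (_ , s , _) → not₂ y s) ]′ ⊥-elim
  edg (inj₂ x) (inj₂ y) = mk⇔
    [ (λ (s , _) → ⊥-elim (not₁ x s)) , (λ (_ , _ , p) → to (edges r₂ x y) p) ]′
    (λ p → inj₂ (vertex-∈ r₂ x , vertex-∈ r₂ y , from (edges r₂ x y) p))

-- Simultaneous relabelling by single renamings

renameLabel : Fin m → Fin m → Fin m → Fin m
renameLabel i j x = if does (x ≟ i) then j else x

rename-realisation : (i j : Fin m) → Realisation S ℓ R →
  Realisation S (renameLabel i j ∘ ℓ) R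
rename-realisation i j r = record
  { expression = rename i j (expression r)
  ; vertex     = vertex r
  ; vertex-∈   = vertex-∈ r
  ; injective  = injective r
  ; surjective = surjective r
  ; labels     = λ x → cong (renameLabel i j) (labels r x)
  ; edges      = edges r
  }

module _ (φ : Fin m → Fin m) (φ-idem : ∀ x → φ (φ x) ≡ φ x) where

  renameLabels : List (Fin m) → Fin m → Fin m
  renameLabels []       = id
  renameLabels (i ∷ is) = renameLabels is ∘ renameLabel i (φ i)

  -- Only the renaming of `φ x` itself could affect this label, and by idempotence it sends `φ x` to
  -- `φ x`.
  renameLabels-fixed : ∀ is x → renameLabels is (φ x) ≡ φ x
  renameLabels-fixed []       x = refl
  renameLabels-fixed (i ∷ is) x with φ x ≟ i
  ... | yes refl = trans (cong (renameLabels is) (φ-idem x)) (renameLabels-fixed is x)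
  ... | no  _    = renameLabels-fixed is x

  -- The label `x` is untouched until its first occurrence in the list, which moves it to `φ x`;
  -- later renamings leave it there.
  renameLabels-∈ : ∀ {is x} → x ∈ₗ is → renameLabels is x ≡ φ x
  renameLabels-∈ {i ∷ is} {x} x∈ with x ≟ i | x∈
  ... | yes refl | _         = renameLabels-fixed is x
  ... | no  x≢i  | here eq   = contradiction eq x≢i
  ... | no  _    | there x∈′ = renameLabels-∈ x∈′

  -- Idempotence makes the order of the individual renamings irrelevant.
  relabel-realisation : Realisation S ℓ R → Realisation S (φ ∘ ℓ) R
  relabel-realisation {S = S} {R = R} =
    realisation-resp (mk⇔ id id) (λ _ → renameLabels-∈ (∈-allFin _)) (λ _ _ → mk⇔ id id) ∘ go (allFin m)
    where
    go : ∀ is {ℓ} → Realisation S ℓ R → Realisation S (renameLabels is ∘ ℓ) R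
    go []       r = r
    go (i ∷ is) r = go is (rename-realisation i (φ i) r)

-- Joining all pairs of labels in a relation

join-realisation : (i j : Fin m) → i ≢ j → Realisation S ℓ R →
  Realisation S ℓ (λ u v → R u v ⊎ (ℓ u ≡ i × ℓ v ≡ j) ⊎ (ℓ u ≡ j × ℓ v ≡ i))
join-realisation i j i≢j r = record
  { expression = join i j i≢j (expression r)
  ; vertex     = vertex r
  ; vertex-∈   = vertex-∈ r
  ; injective  = injective r
  ; surjective = surjective r
  ; labels     = labels r
  ; edges      = λ x y → mk⇔
      (Sum.map (to (edges r x y)) (Sum.map
        (λ (p , q) → trans (labels r x) p , trans (labels r y) q)
        (λ (p , q) → trans (labels r x) p , trans (labels r y) q)))
      (Sum.map (from (edges r x y)) (Sum.map
        (λ (p , q) → trans (sym (labels r x)) p , trans (sym (labels r y)) q)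
        (λ (p , q) → trans (sym (labels r x)) p , trans (sym (labels r y)) q)))
  }

JoinedBy : Rel (Fin m) 0ℓ → (Fin n → Fin m) → Rel (Fin n) 0ℓ
JoinedBy J ℓ u v = J (ℓ u) (ℓ v) ⊎ J (ℓ v) (ℓ u)

-- The pairs of labels are scanned one by one, with a `join` for each pair in `J`. Joins do not
-- change labels, so `ℓ` serves throughout; irreflexivity of `J` supplies the `i ≢ j` that `join`
-- demands.
joins-realisation : (J : Rel (Fin m) 0ℓ) → Decidable J → (∀ {i} → ¬ J i i) →
  Realisation S ℓ R → Realisation S ℓ (λ u v → R u v ⊎ JoinedBy J ℓ u v)
joins-realisation {m = m} {S = S} {ℓ = ℓ} J J? J-irrefl =
  resp (λ {u} {v} → mk⇔ (Sum.map₂ (Sum.map (all ,_) (all ,_)))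
                        (Sum.map₂ (Sum.map proj₂ proj₂)))
  ∘ go (cartesianProduct (allFin m) (allFin m))
  where
  resp : (∀ {u v} → R′ u v ⇔ R u v) → Realisation S ℓ R → Realisation S ℓ R′
  resp R⇔ = realisation-resp (mk⇔ id id) (λ _ → refl) (λ _ _ → R⇔)

  all : ∀ {i j} → (i , j) ∈ₗ cartesianProduct (allFin m) (allFin m)
  all = ∈-cartesianProduct⁺ (∈-allFin _) (∈-allFin _)

  -- Cutting `J` down to the listed pairs describes what the joins for those pairs contribute. On
  -- the full product this is `J` again.
  J[_] : List (Fin m × Fin m) → Rel (Fin m) 0ℓ
  J[ ps ] i j = (i , j) ∈ₗ ps × J i j

  -- `R` has to vary: in the recursive call it may have absorbed the join for the head of the list.
  go : ∀ ps {R} → Realisation S ℓ R → Realisation S ℓ (λ u v → R u v ⊎ JoinedBy J[ ps ] ℓ u v)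
  go [] = resp (mk⇔ (λ { (inj₁ p) → p ; (inj₂ (inj₁ ())) ; (inj₂ (inj₂ ())) }) inj₁)
  go ((i , j) ∷ ps) {R} r with J? i j
  ... | no ¬Jij = resp (mk⇔ (Sum.map₂ (Sum.map drop drop)) (Sum.map₂ (Sum.map weaken weaken))) (go ps r)
    where
    drop : ∀ {x y} → J[ (i , j) ∷ ps ] x y → J[ ps ] x y
    drop (here refl , Jxy) = contradiction Jxy ¬Jij
    drop (there p   , Jxy) = p , Jxy
    weaken : ∀ {x y} → J[ ps ] x y → J[ (i , j) ∷ ps ] x y
    weaken (p , Jxy) = there p , Jxy
  ... | yes Jij = resp (mk⇔ split merge) (go ps (join-realisation i j (λ { refl → J-irrefl Jij }) r))
    where
    Joined : Rel _ 0ℓ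
    Joined u v = R u v ⊎ (ℓ u ≡ i × ℓ v ≡ j) ⊎ (ℓ u ≡ j × ℓ v ≡ i)
    case : ∀ {x y} → J[ (i , j) ∷ ps ] x y → (x ≡ i × y ≡ j) ⊎ J[ ps ] x y
    case (here refl , Jxy) = inj₁ (refl , refl)
    case (there p   , Jxy) = inj₂ (p , Jxy)
    split : ∀ {u v} → R u v ⊎ JoinedBy J[ (i , j) ∷ ps ] ℓ u v → Joined u v ⊎ JoinedBy J[ ps ] ℓ u v
    split (inj₁ p) = inj₁ (inj₁ p)
    split (inj₂ (inj₁ q)) = Sum.map (inj₂ ∘ inj₁) inj₁ (case q)
    split (inj₂ (inj₂ q)) = Sum.map (λ (a , b) → inj₂ (inj₂ (b , a))) inj₂ (case q)
    first : ∀ {x y} → x ≡ i → y ≡ j → J[ (i , j) ∷ ps ] x y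
    first refl refl = here refl , Jij
    merge : ∀ {u v} → Joined u v ⊎ JoinedBy J[ ps ] ℓ u v → R u v ⊎ JoinedBy J[ (i , j) ∷ ps ] ℓ u v
    merge (inj₁ (inj₁ p)) = inj₁ p
    merge (inj₁ (inj₂ (inj₁ (a , b)))) = inj₂ (inj₁ (first a b))
    merge (inj₁ (inj₂ (inj₂ (a , b)))) = inj₂ (inj₂ (first b a))
    merge (inj₂ q) = inj₂ (Sum.map (λ (p , Jxy) → there p , Jxy) (λ (p , Jxy) → there p , Jxy) q)

-- Labels as pairs of a side and a part

-- Side `suc zero` sets the second half apart, and side `zero` restores the original labels at the
-- end. Overwriting the side, unlike swapping the two sides, is idempotent, as `relabel-realisation`
-- requires.
toSide : (k : ℕ) → Fin 2 → Fin (2 * k) → Fin (2 * k)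
toSide k s x = combine s (proj₂ (remQuot {2} k x))

toSide-combine : (s t : Fin 2) (i : Fin k) → toSide k s (combine t i) ≡ combine s i
toSide-combine s t i = cong (combine s ∘ proj₂) (remQuot-combine t i)

toSide-idem : (s : Fin 2) (x : Fin (2 * k)) → toSide k s (toSide k s x) ≡ toSide k s x
toSide-idem {k} s x = toSide-combine s s (proj₂ (remQuot {2} k x))

_∈⋃?_ : (v : Fin n) (W : Family k n) → Dec (v ∈⋃ W)
v ∈⋃? W = any? λ i → v ∈? W i

sideLabel : Fin 2 → (Fin n → Fin k) → Fin n → Fin (2 * k)
sideLabel s part v = combine s (part v)

-- One decomposition step and the recursion

module _ {G : Graph n} (part : Fin n → Fin k) where
  open Graph G using (Adj; adj?; irrefl) renaming (sym to adj-sym)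

  module _ {W W′ W″ : Family k n} (W⇒part : ∀ {i v} → v ∈ W i → part v ≡ i)
           (d : IsKDecomposition G W W′ W″) where
    open IsKDecomposition d

    ′⊆ : ∀ {i v} → v ∈ W′ i → v ∈ W i
    ′⊆ {i} {v} p = subst (v ∈_) (union i) (x∈p∪q⁺ (inj₁ p))

    ″⊆ : ∀ {i v} → v ∈ W″ i → v ∈ W i
    ″⊆ {i} {v} p = subst (v ∈_) (union i) (x∈p∪q⁺ (inj₂ p))

    ∈′part : ∀ {v} → v ∈⋃ W′ → v ∈ W′ (part v)
    ∈′part {v} (i , p) = subst (λ j → v ∈ W′ j) (sym (W⇒part (′⊆ p))) p

    ∈″part : ∀ {v} → v ∈⋃ W″ → v ∈ W″ (part v)
    ∈″part {v} (i , p) = subst (λ j → v ∈ W″ j) (sym (W⇒part (″⊆ p))) p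

    ⋃-union : ∀ {v} → (v ∈⋃ W′ ⊎ v ∈⋃ W″) ⇔ v ∈⋃ W
    ⋃-union {v} = mk⇔
      [ (λ (i , p) → i , ′⊆ p) , (λ (i , p) → i , ″⊆ p) ]′
      (λ (i , p) → Sum.map (i ,_) (i ,_) (x∈p∪q⁻ (W′ i) (W″ i) (subst (v ∈_) (sym (union i)) p)))

    -- Disjointness is given index by index, so both memberships are first moved to the index
    -- `part v`.
    ⋃-disjoint : ∀ {v} → v ∈⋃ W′ → ¬ v ∈⋃ W″
    ⋃-disjoint {v} p q = disjoint (part v) (v , x∈p∩q⁺ (∈′part p , ∈″part q))

    -- Vertices outside `W` also land on side `suc zero`. This default is harmless, since labels are
    -- compared only on `W`.
    side : Fin n → Fin 2
    side v = if does (v ∈⋃? W′) then zero else suc zero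

    side-′ : ∀ {v} → v ∈⋃ W′ → side v ≡ zero
    side-′ {v} p with v ∈⋃? W′
    ... | yes _ = refl
    ... | no ¬p = contradiction p ¬p

    side-″ : ∀ {v} → v ∈⋃ W″ → side v ≡ suc zero
    side-″ {v} p with v ∈⋃? W′
    ... | yes q = contradiction p (⋃-disjoint q)
    ... | no _  = refl

    -- The labelling between the two relabellings, while the halves are still kept apart.
    currentLabel : Fin n → Fin (2 * k)
    currentLabel v = combine (side v) (part v)

    Crossing : Rel (Fin n) 0ℓ
    Crossing u v = u ∈⋃ W′ × v ∈⋃ W″ × Adj u v

    -- Two labels are joined as soon as one edge of `G` crosses between their classes, which a
    -- finite search decides. That no false edge arises is `labels⇒adj`.
    CrossingLabels : Rel (Fin (2 * k)) 0ℓ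
    CrossingLabels x y = ∃[ u ] ∃[ v ] Crossing u v × x ≡ sideLabel zero part u × y ≡ sideLabel (suc zero) part v

    crossingLabels? : Decidable CrossingLabels
    crossingLabels? x y = any? λ u → any? λ v →
      ((u ∈⋃? W′) ×-dec (v ∈⋃? W″) ×-dec adj? u v) ×-dec (x ≟ _) ×-dec (y ≟ _)

    combine-side≢ : ∀ {i j : Fin k} → combine {2} zero i ≢ combine {2} (suc zero) j
    combine-side≢ {i} {j} eq with () ← proj₁ (combine-injective {2} zero i (suc zero) j eq)

    crossingLabels-irrefl : ∀ {x} → ¬ CrossingLabels x x
    crossingLabels-irrefl (u , v , _ , p , q) = combine-side≢ (trans (sym p) q)

    crossing⇒labels : ∀ {u v} → Crossing u v → CrossingLabels (currentLabel u) (currentLabel v)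
    crossing⇒labels {u} {v} c@(p , q , _) =
      u , v , c , cong (λ s → combine s (part u)) (side-′ p) , cong (λ s → combine s (part v)) (side-″ q)

    -- Equal labels put `u` and `v` into the same classes as the witnesses `u₀` and `v₀`. The edge
    -- between the witnesses excludes the anti-complete case of `uniform`, so the classes are
    -- complete to each other.
    labels⇒adj : ∀ {u v} → u ∈⋃ W → v ∈⋃ W → CrossingLabels (currentLabel u) (currentLabel v) → Adj u v
    labels⇒adj {u} {v} u∈ v∈ (u₀ , v₀ , (u₀∈ , v₀∈ , a) , p , q)
      with combine-injective (side u) (part u) zero (part u₀) p
         | combine-injective (side v) (part v) (suc zero) (part v₀) q
    ... | su , pu | sv , pv with from ⋃-union u∈ | from ⋃-union v∈ | uniform (part u₀) (part v₀)
    ... | inj₂ u∈″ | _        | _      = contradiction (trans (sym (side-″ u∈″)) su) λ ()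
    ... | inj₁ _   | inj₁ v∈′ | _      = contradiction (trans (sym (side-′ v∈′)) sv) λ ()
    ... | inj₁ _   | inj₂ _   | inj₂ n = contradiction a (n u₀ v₀ (∈′part u₀∈) (∈″part v₀∈))
    ... | inj₁ u∈′ | inj₂ v∈″ | inj₁ c =
      c u v (subst (λ i → u ∈ W′ i) pu (∈′part u∈′)) (subst (λ i → v ∈ W″ i) pv (∈″part v∈″))

    -- Exactly the shape of edge relation that `⊕-realisation` followed by `joins-realisation`
    -- delivers.
    Built : Rel (Fin n) 0ℓ
    Built u v = (Within (_∈⋃ W′) Adj u v ⊎ Within (_∈⋃ W″) Adj u v) ⊎ JoinedBy CrossingLabels currentLabel u v

    adj⇔built : ∀ {u v} → u ∈⋃ W → v ∈⋃ W → Adj u v ⇔ Built u v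
    adj⇔built {u} {v} u∈ v∈ = mk⇔ (build (from ⋃-union u∈) (from ⋃-union v∈))
      [ [ proj₂ ∘ proj₂ , proj₂ ∘ proj₂ ]′ , [ labels⇒adj u∈ v∈ , adj-sym ∘ labels⇒adj v∈ u∈ ]′ ]′
      where
      build : u ∈⋃ W′ ⊎ u ∈⋃ W″ → v ∈⋃ W′ ⊎ v ∈⋃ W″ → Adj u v → Built u v
      build (inj₁ p) (inj₁ q) a = inj₁ (inj₁ (p , q , a))
      build (inj₁ p) (inj₂ q) a = inj₂ (inj₁ (crossing⇒labels (p , q , a)))
      build (inj₂ p) (inj₁ q) a = inj₂ (inj₂ (crossing⇒labels (q , p , adj-sym a)))
      build (inj₂ p) (inj₂ q) a = inj₁ (inj₂ (p , q , a))

    decomposition-realisation :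
      Realisation (_∈⋃ W′) (sideLabel zero part) Adj → Realisation (_∈⋃ W″) (sideLabel zero part) Adj →
      Realisation (_∈⋃ W) (sideLabel zero part) Adj
    decomposition-realisation r′ r″ =
      realisation-resp ⋃-union (λ {v} _ → toSide-combine zero (side v) (part v))
        (λ p q → adj⇔built (to ⋃-union p) (to ⋃-union q))
        (relabel-realisation (toSide k zero) (toSide-idem {k} zero)
          (joins-realisation CrossingLabels crossingLabels? crossingLabels-irrefl
            (⊕-realisation ⋃-disjoint
              -- `⊕-realisation` expects one labelling shared by both halves. Each half's own
              -- labelling agrees with `currentLabel` on its vertices.
              (relabelled (λ {v} p → cong (λ s → combine s (part v)) (sym (side-′ p))) r′)
              (relabelled (λ {v} p → trans (toSide-combine (suc zero) zero (part v))
                                           (cong (λ s → combine s (part v)) (sym (side-″ p))))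
                (relabel-realisation (toSide k (suc zero)) (toSide-idem {k} (suc zero)) r″)))))
      where
      relabelled : (∀ {v} → S v → ℓ v ≡ ℓ′ v) → Realisation S ℓ Adj → Realisation S ℓ′ Adj
      relabelled ℓ≡ = realisation-resp (mk⇔ id id) ℓ≡ (λ _ _ → mk⇔ id id)

  -- The function `part` stays fixed during the induction: subfamilies inherit the hypothesis on
  -- `W`, so all labels refer to the original partition.
  totallyDecomposable-realisation : {W : Family k n} → (∀ {i v} → v ∈ W i → part v ≡ i) →
    TotallyKDecomposable G W → Realisation (_∈⋃ W) (sideLabel zero part) Adj
  totallyDecomposable-realisation {W} _ (isK₁ (v₀ , v₀∈ , unique)) =
    single-realisation v₀ (mk⇔ (λ eq → subst (_∈⋃ W) eq v₀∈) unique) (irrefl v₀)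
  totallyDecomposable-realisation W⇒part (decompose W′ W″ d t′ t″) =
    decomposition-realisation W⇒part d
      (totallyDecomposable-realisation (W⇒part ∘ ′⊆ W⇒part d) t′)
      (totallyDecomposable-realisation (W⇒part ∘ ″⊆ W⇒part d) t″)

-- From realisations to expressions of the whole graph

module _ {G : Graph n} (r : Realisation S ℓ (Graph.Adj G)) (total : ∀ v → S v) where

  realisation⇒isExpression : expression r IsExpressionOf G
  realisation⇒isExpression = record
    { vertices = mk↔ₛ′ name (vertex r) (λ x → injective r (vertex-name (vertex r x))) vertex-name
    ; edges    = λ u v → subst₂ (λ u′ v′ → Graph.Adj G u′ v′ ⇔ Edge (expression r) (name u) (name v))
                           (vertex-name u) (vertex-name v) (edges r (name u) (name v))
    }
    where
    name : Fin n → Vertex (expression r)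
    name v = proj₁ (surjective r (total v))

    vertex-name : ∀ v → vertex r (name v) ≡ v
    vertex-name v = proj₂ (surjective r (total v))

  labelOf≡ : ∀ v → _IsExpressionOf_.labelOf realisation⇒isExpression v ≡ ℓ v
  labelOf≡ v = let (x , eq) = surjective r (total v) in trans (labels r x) (cong ℓ eq)

-- `combine` encodes the pair of `zero` and `i` as `k * 0 + toℕ i`, so a part keeps its number as a
-- label in the larger label set.
toℕ-combine-zero : (i : Fin k) → toℕ (combine {2} zero i) ≡ toℕ i
toℕ-combine-zero {k} i = trans (toℕ-combine {2} zero i) (cong (λ z → z + toℕ i) (*-zeroʳ k))

lemma7 : (k : ℕ) → 2 ≤ k → {n : ℕ} (G : Graph n) (V : Family k n) →
    IsKPartition G V →
    TotallyKDecomposable G V →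
    (∀ w → IsCliqueWidth G w → w ≤ 2 * k) ×
    Σ (Expression (2 * k)) λ e → Σ (e IsExpressionOf G) λ r →
    ∀ i v → v ∈ V i → toℕ (_IsExpressionOf_.labelOf r v) ≡ toℕ i
lemma7 k _ {n} G V P t =
  (λ w c → IsCliqueWidth.minimal c (2 * k) (expression r , isExpr)) ,
  expression r , isExpr , λ i v v∈ → begin
    toℕ (_IsExpressionOf_.labelOf isExpr v) ≡⟨ cong toℕ (labelOf≡ {G = G} r covers v) ⟩
    toℕ (combine {2} zero (part v))         ≡⟨ toℕ-combine-zero (part v) ⟩
    toℕ (part v)                            ≡⟨ cong toℕ (V⇒part v∈) ⟩
    toℕ i                                   ∎
  where
  open ≡-Reasoning
  open IsKPartition P

  -- `covers` yields some class containing `v`; by disjointness it is the only one, which gives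
  -- `V⇒part`.
  part : Fin n → Fin k
  part v = proj₁ (covers v)

  V⇒part : ∀ {i v} → v ∈ V i → part v ≡ i
  V⇒part {i} {v} v∈ with part v ≟ i
  ... | yes eq = eq
  ... | no ≢i  = contradiction (v , x∈p∩q⁺ (proj₂ (covers v) , v∈)) (disjoint (part v) i ≢i)

  r : Realisation (_∈⋃ V) (sideLabel zero part) (Graph.Adj G)
  r = totallyDecomposable-realisation part V⇒part t

  isExpr : expression r IsExpressionOf G
  isExpr = realisation⇒isExpression r covers
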